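{- For integers $n,i,j\ge0$ and $m\in\{1,2\}$, $D^{\mathrm{I}}_m(i,j,n)=D^{\mathrm{II}}_m(i,j,n)$, where $D^{\mathrm{I}}_m(i,j,n)$ is the number of partitions of $n$ into distinct parts $\not\equiv -m\pmod3$ having exactly $i$ odd-indexed parts $\equiv m\pmod 3$ and exactly $j$ even-indexed parts $\equiv m\pmod3$, and $D^{\mathrm{II}}_m(i,j,n)$ is the number of partitions of $n$ into distinct parts $\not\equiv-m\pmod3$ having exactly $i$ parts $\equiv m\pmod6$ and exactly $j$ parts $\equiv m+3\pmod6$.
   Context: For a partition $\pi=(\pi_1>\pi_2>\cdots)$, the odd-indexed parts are $\pi_1,\pi_3,\dots$ and the even-indexed parts are $\pi_2,\pi_4,\dots$. -}

module Defs where

open import Data.Nat using (ℕ; zero; suc; _+_; _∸_; _<_; _%_; NonZero)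
open import Data.List using (List; []; _∷_; filter; length)
open import Data.Nat.ListAction using (sum)
open import Data.List.Relation.Unary.All using (All)
open import Relation.Binary.PropositionalEquality using (_≡_; _≢_)
open import Relation.Nullary.Decidable using (¬?)
open import Data.Nat using (_≟_)
open import Data.Product using (Σ; _×_)

data StrictlyDecreasing : List ℕ → Set where
  []  : StrictlyDecreasing []
  [_] : ∀ x → StrictlyDecreasing (x ∷ [])
  _∷_ : ∀ {x y xs} → y < x → StrictlyDecreasing (y ∷ xs) →
        StrictlyDecreasing (x ∷ y ∷ xs)

Positive : ℕ → Set
Positive x = 0 < x

IsDistinctPartition : ℕ → List ℕ → Set
IsDistinctPartition n π = StrictlyDecreasing π × All Positive π × sum π ≡ n

oddIndexed : List ℕ → List ℕ
evenIndexed : List ℕ → List ℕ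
oddIndexed [] = []
oddIndexed (x ∷ xs) = x ∷ evenIndexed xs
evenIndexed [] = []
evenIndexed (x ∷ xs) = oddIndexed xs

countMod : (k : ℕ) .{{_ : NonZero k}} → ℕ → List ℕ → ℕ
countMod k r xs = length (filter (λ x → x % k ≟ r % k) xs)

-- the residue of -m modulo 3, for m ∈ {1,2}: it is 3 - m
-- parts ≢ -m (mod 3)
AvoidsNegMod3 : ℕ → List ℕ → Set
AvoidsNegMod3 m π = All (λ x → x % 3 ≢ (6 ∸ m) % 3) π

DI : ℕ → ℕ → ℕ → ℕ → Set
DI m i j n = Σ (List ℕ) λ π →
  IsDistinctPartition n π × AvoidsNegMod3 m π ×
  countMod 3 m (oddIndexed π) ≡ i × countMod 3 m (evenIndexed π) ≡ j

DII : ℕ → ℕ → ℕ → ℕ → Set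
DII m i j n = Σ (List ℕ) λ π →
  IsDistinctPartition n π × AvoidsNegMod3 m π ×
  countMod 6 m π ≡ i × countMod 6 (m + 3) π ≡ j

{-# OPTIONS --safe #-}

-- The admissible parts are m < 3 < 3+m < 6 < 6+m < …, so a partition is a finite
-- set of ranks, the part 3c+m having the even rank 2c.  For c ≥ 1 call c single
-- if exactly one of 3c, 3c+m occurs.  Reading from the top, the parity of the
-- position of a part 3c+m depends only on the number of singles above c.
-- Therefore moving the choices "3c+m rather than 3c" of the singles one single
-- down, the top choice becoming an extra bit e and the bottom single receiving
-- the choice whether the part m occurs, and then decreasing all parts 3c+m by 3,
-- is a weight-controlled bijection that exchanges the roles of odd and even
-- positions up to e.  For the residues modulo 6 the same recurrence holds
-- trivially (e tells whether m occurs, the other parts 3c+m decrease by 3), and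
-- without parts ≡ m the two kinds of partitions coincide.
module Submission where

open import Defs
open import Data.Bool using (Bool; true; false; not)
open import Data.List using (List; []; _∷_)
open import Data.List.Properties using (∷-injectiveʳ)
open import Data.List.Relation.Unary.All as All using (All; []; _∷_)
open import Data.Nat
open import Data.Nat.ListAction using (sum)
open import Data.Nat.Properties
open import Data.Nat.Tactic.RingSolver using (solve-∀)
open import Data.Product using (Σ; Σ-syntax; ∃; _×_; _,_; proj₁; proj₂)
open import Data.Product.Function.Dependent.Propositional using (congˡ)
open import Data.Sum using (_⊎_; inj₁; inj₂; [_,_]′)
open import Data.Vec using (Vec; []; _∷_)
open import Function.Bundles using (_↔_; mk↔ₛ′)
open import Function.Properties.Inverse using (↔-sym; ↔-trans)
open import Relation.Binary.Definitions using (tri<; tri≈; tri>)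
open import Relation.Binary.PropositionalEquality
open import Relation.Nullary using (Irrelevant; contradiction)

-- Irrelevance of proofs, decreasing lists, counts of residues.

bit : Bool → ℕ
bit true  = 1
bit false = 0

-- The conditions on partitions and vectors are propositions, so the round trips below need checking
-- only on the underlying lists and vectors.
Σ-≡ : {A : Set} {P : A → Set} → (∀ {x} → Irrelevant (P x)) →
      {a b : Σ A P} → proj₁ a ≡ proj₁ b → a ≡ b
Σ-≡ irr refl = cong (_ ,_) (irr _ _)

×-irrelevant : {A B : Set} → Irrelevant A → Irrelevant B → Irrelevant (A × B)
×-irrelevant irrA irrB (a , b) (a′ , b′) = cong₂ _,_ (irrA a a′) (irrB b b′)

StrictlyDecreasing-irrelevant : ∀ {xs} → Irrelevant (StrictlyDecreasing xs)
StrictlyDecreasing-irrelevant []      []        = refl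
StrictlyDecreasing-irrelevant [ x ]   [ .x ]    = refl
StrictlyDecreasing-irrelevant (p ∷ ps) (q ∷ qs) =
  cong₂ _∷_ (<-irrelevant p q) (StrictlyDecreasing-irrelevant ps qs)

StrictlyDecreasing-tail : ∀ {x xs} → StrictlyDecreasing (x ∷ xs) → StrictlyDecreasing xs
StrictlyDecreasing-tail [ _ ]    = []
StrictlyDecreasing-tail (_ ∷ ps) = ps

StrictlyDecreasing⇒All< : ∀ {x xs} → StrictlyDecreasing (x ∷ xs) → All (_< x) xs
StrictlyDecreasing⇒All< [ _ ]      = []
StrictlyDecreasing⇒All< (y<x ∷ ps) =
  y<x ∷ All.map (λ z<y → <-trans z<y y<x) (StrictlyDecreasing⇒All< ps)

All<⇒StrictlyDecreasing : ∀ {x xs} → All (_< x) xs → StrictlyDecreasing xs →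
                          StrictlyDecreasing (x ∷ xs)
All<⇒StrictlyDecreasing []        _  = [ _ ]
All<⇒StrictlyDecreasing (y<x ∷ _) ps = y<x ∷ ps

x∈xs⇒x≤sum : ∀ xs → All (_≤ sum xs) xs
x∈xs⇒x≤sum []       = []
x∈xs⇒x≤sum (x ∷ xs) =
  m≤m+n x _ ∷ All.map (λ y≤ → ≤-trans y≤ (m≤n+m _ x)) (x∈xs⇒x≤sum xs)

countMod-∷ : ∀ k .{{_ : NonZero k}} r x xs →
             countMod k r (x ∷ xs) ≡ countMod k r (x ∷ []) + countMod k r xs
-- The decision `_≟_` computes through `≡ᵇ`; abstracting this Boolean lets `filter` reduce on both
-- sides.
countMod-∷ k r x xs with x % k ≡ᵇ r % k
... | true  = refl
... | false = refl

countMod-[-]-cong : ∀ k .{{_ : NonZero k}} r {x y} → x % k ≡ y % k →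
                    countMod k r (x ∷ []) ≡ countMod k r (y ∷ [])
countMod-[-]-cong k r {x} {y} eq with x % k | y % k | eq
... | a | .a | refl with a ≡ᵇ r % k
...   | true  = refl
...   | false = refl

-- α and β are the indicators of the ranks ≡ 0 and ≡ 2 (mod 4).
α β : ℕ → ℕ
α 0             = 1
α 1             = 0
α (suc (suc r)) = β r
β 0             = 0
β 1             = 0
β (suc (suc r)) = α r

α+β-even : ∀ k → α (k * 2) + β (k * 2) ≡ 1
α+β-even zero    = refl
α+β-even (suc k) = trans (+-comm (β (k * 2)) _) (α+β-even k)

α-odd : ∀ k → α (suc (k * 2)) ≡ 0
β-odd : ∀ k → β (suc (k * 2)) ≡ 0
α-odd zero    = refl
α-odd (suc k) = β-odd k
β-odd zero    = refl
β-odd (suc k) = α-odd k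

-- Admissible parts indexed by rank.

module Parts (m : ℕ) (m∈ : m ≡ 1 ⊎ m ≡ 2) where

  -- Transporting a predicate from the literals 1 and 2 lets the remainders in the finite checks
  -- compute.
  m-elim : (P : ℕ → Set) → P 1 → P 2 → P m
  m-elim P P1 P2 = [ (λ m≡1 → subst P (sym m≡1) P1) , (λ m≡2 → subst P (sym m≡2) P2) ]′ m∈

  m>0 : 0 < m
  m>0 = m-elim (0 <_) (s≤s z≤n) (s≤s z≤n)

  m<3 : m < 3
  m<3 = m-elim (_< 3) (s≤s (s≤s z≤n)) (s≤s (s≤s (s≤s z≤n)))

  part : ℕ → ℕ
  part 0             = m
  part 1             = 3
  part (suc (suc r)) = 3 + part r

  part>0 : ∀ r → 0 < part r
  part>0 0             = m>0
  part>0 1             = s≤s z≤n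
  part>0 (suc (suc r)) = s≤s z≤n

  part-mono-< : ∀ {r s} → r < s → part r < part s
  part-mono-< {0} {1} _ = m<3
  part-mono-< {0} {suc (suc s)} _ = ≤-trans m<3 (m≤m+n 3 _)
  part-mono-< {1} {1} (s≤s ())
  part-mono-< {1} {suc (suc s)} _ = m<m+n 3 (part>0 s)
  part-mono-< {suc (suc r)} {suc (suc s)} (s≤s (s≤s r<s)) =
    +-monoʳ-< 3 (part-mono-< r<s)

  part-cancel-< : ∀ {r s} → part r < part s → r < s
  part-cancel-< {r} {s} lt with <-cmp r s
  ... | tri< r<s _ _ = r<s
  ... | tri≈ _ refl _ = contradiction lt (<-irrefl refl)
  ... | tri> _ _ s<r = contradiction lt (<-asym (part-mono-< s<r))

  -- Choosing 3c+m over 3c, here with c = k+1, gains `m` for every c. Hence moving choices between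
  -- singles preserves the weight.
  part-odd : ∀ k → part (suc (k * 2)) + m ≡ 3 + part (k * 2)
  part-odd zero    = refl
  part-odd (suc k) = cong (3 +_) (part-odd k)

  n<part[n*2] : ∀ n → n < part (n * 2)
  n<part[n*2] zero    = m>0
  n<part[n*2] (suc n) = s≤s (≤-trans (n<part[n*2] n) (m≤n+m _ 2))

  part-avoids : ∀ r → part r % 3 ≢ (6 ∸ m) % 3
  part-avoids 0 = m-elim (λ m → m % 3 ≢ (6 ∸ m) % 3) (λ ()) (λ ())
  part-avoids 1 = m-elim (λ m → 3 % 3 ≢ (6 ∸ m) % 3) (λ ()) (λ ())
  part-avoids (suc (suc r)) = part-avoids r

  part-surjective : ∀ x → Positive x → x % 3 ≢ (6 ∸ m) % 3 → ∃ λ r → part r ≡ x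
  part-surjective 0 () _
  part-surjective 1 _ avoids =
    0 , m-elim (λ m → 1 % 3 ≢ (6 ∸ m) % 3 → m ≡ 1) (λ _ → refl) (contradiction refl) avoids
  part-surjective 2 _ avoids =
    0 , m-elim (λ m → 2 % 3 ≢ (6 ∸ m) % 3 → m ≡ 2) (contradiction refl) (λ _ → refl) avoids
  part-surjective 3 _ _ = 1 , refl
  part-surjective (suc (suc (suc (suc x)))) _ avoids
    with part-surjective (suc x) (s≤s z≤n) avoids
  ... | r , eq = suc (suc r) , cong (3 +_) eq

  countMod3-part : ∀ r → countMod 3 m (part r ∷ []) ≡ α r + β r
  countMod3-part 0 = m-elim (λ m → countMod 3 m (m ∷ []) ≡ 1) refl refl
  countMod3-part 1 = m-elim (λ m → countMod 3 m (3 ∷ []) ≡ 0) refl refl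
  -- Two ranks up, the residue modulo 3 is the same but `α` and `β` are exchanged.
  countMod3-part (suc (suc r)) =
    trans (countMod-[-]-cong 3 m {3 + part r} {part r} refl)
          (trans (countMod3-part r) (+-comm (α r) (β r)))

  -- Two ranks add 3 to the part, so the residues modulo 6 recur after four ranks.
  countMod6-part : ∀ r → countMod 6 m (part r ∷ []) ≡ α r ×
                         countMod 6 (m + 3) (part r ∷ []) ≡ β r
  countMod6-part 0 =
    m-elim (λ m → countMod 6 m (m ∷ []) ≡ 1 × countMod 6 (m + 3) (m ∷ []) ≡ 0)
           (refl , refl) (refl , refl)
  countMod6-part 1 =
    m-elim (λ m → countMod 6 m (3 ∷ []) ≡ 0 × countMod 6 (m + 3) (3 ∷ []) ≡ 0)
           (refl , refl) (refl , refl)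
  countMod6-part 2 =
    m-elim (λ m → countMod 6 m (3 + m ∷ []) ≡ 0 × countMod 6 (m + 3) (3 + m ∷ []) ≡ 1)
           (refl , refl) (refl , refl)
  countMod6-part 3 =
    m-elim (λ m → countMod 6 m (6 ∷ []) ≡ 0 × countMod 6 (m + 3) (6 ∷ []) ≡ 0)
           (refl , refl) (refl , refl)
  countMod6-part (suc (suc (suc (suc r)))) =
    trans (countMod-[-]-cong 6 m {6 + part r} {part r} refl) (proj₁ (countMod6-part r)) ,
    trans (countMod-[-]-cong 6 (m + 3) {6 + part r} {part r} refl) (proj₂ (countMod6-part r))

  -- Partitions as characteristic vectors.

  -- The first bit of a vector belongs to its largest rank.
  parts : ∀ {b} → Vec Bool b → List ℕ
  parts []                  = []
  parts (false ∷ v)         = parts v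
  parts {suc b} (true ∷ v)  = part b ∷ parts v

  parts-All : ∀ {P : ℕ → Set} → (∀ r → P (part r)) → ∀ {b} (v : Vec Bool b) → All P (parts v)
  parts-All f []          = []
  parts-All f (false ∷ v) = parts-All f v
  parts-All f {suc b} (true ∷ v)  = f b ∷ parts-All f v

  parts< : ∀ {b} (v : Vec Bool b) → All (_< part b) (parts v)
  parts< []                  = []
  parts< {suc b} (false ∷ v) = All.map (λ x< → <-trans x< (part-mono-< (n<1+n b))) (parts< v)
  parts< {suc b} (true ∷ v)  =
    part-mono-< (n<1+n b) ∷ All.map (λ x< → <-trans x< (part-mono-< (n<1+n b))) (parts< v)

  parts-decreasing : ∀ {b} (v : Vec Bool b) → StrictlyDecreasing (parts v)
  parts-decreasing []          = []
  parts-decreasing (false ∷ v) = parts-decreasing v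
  parts-decreasing (true ∷ v)  = All<⇒StrictlyDecreasing (parts< v) (parts-decreasing v)

  part∷≢parts : ∀ {b xs} (v : Vec Bool b) → part b ∷ xs ≢ parts v
  part∷≢parts v eq with subst (All _) (sym eq) (parts< v)
  ... | lt ∷ _ = <-irrefl refl lt

  parts-injective : ∀ {b} (v w : Vec Bool b) → parts v ≡ parts w → v ≡ w
  parts-injective []          []          _  = refl
  parts-injective (false ∷ v) (false ∷ w) eq = cong (false ∷_) (parts-injective v w eq)
  parts-injective (false ∷ v) (true ∷ w)  eq = contradiction (sym eq) (part∷≢parts v)
  parts-injective (true ∷ v)  (false ∷ w) eq = contradiction eq (part∷≢parts w)
  parts-injective (true ∷ v)  (true ∷ w)  eq =
    cong (true ∷_) (parts-injective v w (∷-injectiveʳ eq))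

  -- The largest part decides the top bit: if its rank is below the top rank, the bit is `false` and
  -- the whole list is encoded further down; otherwise the bit is `true` and the tail is.
  parts-surjective : ∀ b π → StrictlyDecreasing π → All (λ x → ∃ λ r → part r ≡ x) π →
                     All (_< part b) π → Σ[ v ∈ Vec Bool b ] parts v ≡ π
  parts-surjective zero [] _ _ _ = [] , refl
  parts-surjective zero (_ ∷ _) _ ((r , refl) ∷ _) (lt ∷ _) with part-cancel-< {r} {0} lt
  ... | ()
  parts-surjective (suc b) [] _ _ _ with parts-surjective b [] [] [] []
  ... | v , eq = false ∷ v , eq
  parts-surjective (suc b) (_ ∷ π) dec ((r , refl) ∷ ranks) (lt ∷ _)
    with m≤n⇒m<n∨m≡n (≤-pred (part-cancel-< {r} {suc b} lt))
  ... | inj₁ r<b with parts-surjective b (part r ∷ π) dec ((r , refl) ∷ ranks)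
                        (part-mono-< r<b ∷
                         All.map (λ x< → <-trans x< (part-mono-< r<b)) (StrictlyDecreasing⇒All< dec))
  ...   | v , eq = false ∷ v , eq
  parts-surjective (suc b) (_ ∷ π) dec ((r , refl) ∷ ranks) (lt ∷ _)
      | inj₂ refl with parts-surjective b π (StrictlyDecreasing-tail dec) ranks
                         (StrictlyDecreasing⇒All< dec)
  ...   | v , eq = true ∷ v , cong (part b ∷_) eq

  weight : ∀ {b} → Vec Bool b → ℕ
  weight v = sum (parts v)

  module _ (b n : ℕ) (n<part[b] : n < part b) (p s : List ℕ → ℕ) (i j : ℕ) where

    partitions↔vectors :
      (Σ[ π ∈ List ℕ ] (IsDistinctPartition n π × AvoidsNegMod3 m π × p π ≡ i × s π ≡ j)) ↔
      (Σ[ v ∈ Vec Bool b ] (p (parts v) ≡ i × s (parts v) ≡ j × weight v ≡ n))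
    partitions↔vectors = mk↔ₛ′ to from to∘from from∘to
      where
      Partitions = Σ[ π ∈ List ℕ ] (IsDistinctPartition n π × AvoidsNegMod3 m π × p π ≡ i × s π ≡ j)
      Vectors    = Σ[ v ∈ Vec Bool b ] (p (parts v) ≡ i × s (parts v) ≡ j × weight v ≡ n)

      encode : (z : Partitions) → Σ[ v ∈ Vec Bool b ] parts v ≡ proj₁ z
      encode (π , (dec , pos , refl) , avoids , _ , _) =
        parts-surjective b π dec
          (All.zipWith (λ (x>0 , x≢) → part-surjective _ x>0 x≢) (pos , avoids))
          -- No part exceeds the sum `n`, which is less than `part b`, so `b` bits suffice.
          (All.map (λ x≤n → ≤-<-trans x≤n n<part[b]) (x∈xs⇒x≤sum π))

      to : Partitions → Vectors
      to z@(_ , (_ , _ , sum≡) , _ , p≡ , s≡) with encode z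
      ... | v , refl = v , p≡ , s≡ , sum≡

      parts-to : ∀ z → parts (proj₁ (to z)) ≡ proj₁ z
      parts-to z with encode z
      ... | v , refl = refl

      from : Vectors → Partitions
      from (v , p≡ , s≡ , w≡) =
        parts v , (parts-decreasing v , parts-All part>0 v , w≡) , parts-All part-avoids v , p≡ , s≡

      to∘from : ∀ z → to (from z) ≡ z
      to∘from z = Σ-≡ (×-irrelevant ≡-irrelevant (×-irrelevant ≡-irrelevant ≡-irrelevant))
                      (parts-injective _ _ (parts-to (from z)))

      from∘to : ∀ z → from (to z) ≡ z
      from∘to z = Σ-≡
        (×-irrelevant
          (×-irrelevant StrictlyDecreasing-irrelevant
            (×-irrelevant (All.irrelevant <-irrelevant) ≡-irrelevant))
          -- Two proofs of a negation are definitionally equal, as `⊥` is proof-irrelevant.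
          (×-irrelevant (All.irrelevant (λ _ _ → refl))
            (×-irrelevant ≡-irrelevant ≡-irrelevant)))
        (parts-to z)

  -- The recurrence shared by both kinds of partitions.

  Statistic : Set
  Statistic = ∀ {b} → Vec Bool b → ℕ

  -- With ranks 0 to 2N, what lies above the part `m` groups into the pairs 3c, 3c+m for c from 1 to
  -- N.
  Fibre : Statistic → Statistic → ℕ → ℕ → ℕ → ℕ → Set
  Fibre p s N i j n = Σ[ v ∈ Vec Bool (suc (N * 2)) ] (p v ≡ i × s v ≡ j × weight v ≡ n)

  -- The parameters left after a shift: `e` takes away one unit of the first statistic and weight
  -- `m`, and each of the `i′ + j` remaining marks loses 3.
  Shifted : ℕ → ℕ → ℕ → Bool × ℕ × ℕ → Set
  Shifted i j n (e , i′ , n′) = bit e + i′ ≡ i × bit e * m + (n′ + 3 * (i′ + j)) ≡ n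

  -- `j` comes first in `F` because the shift exchanges the two statistics.
  Unshift : (ℕ → ℕ → ℕ → Set) → ℕ → ℕ → ℕ → Set
  Unshift F i j n =
    Σ[ x ∈ Bool × ℕ × ℕ ] Σ[ _ ∈ Shifted i j n x ] F j (proj₁ (proj₂ x)) (proj₂ (proj₂ x))

  n′≤n : ∀ {i j n} x → Shifted i j n x → proj₂ (proj₂ x) ≤ n
  n′≤n (e , i′ , n′) (_ , refl) = ≤-trans (m≤m+n n′ _) (m≤n+m _ (bit e * m))

  -- This is the termination measure. Either `e` takes one from `i`, or `i′` is `i` and the weight
  -- drops by `3 * (i + j)`, which is positive.
  Shifted-decreases : ∀ {i j n} → 0 < i + j → ∀ x → Shifted i j n x →
                      j + proj₁ (proj₂ x) + proj₂ (proj₂ x) < i + j + n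
  Shifted-decreases {j = j} _ x@(true , i′ , n′) y@(refl , _) =
    s≤s (+-mono-≤ (≤-reflexive (+-comm j i′)) (n′≤n x y))
  Shifted-decreases {j = j} 0<i+j (false , i′ , n′) (refl , refl) =
    +-mono-≤-< (≤-reflexive (+-comm j i′)) (m<m+n n′ (≤-trans 0<i+j (m≤m+n _ _)))

  record Shiftable (p s : Statistic) : Set where
    field
      p-false : ∀ {b} (v : Vec Bool b) → p (false ∷ v) ≡ p v
      s-false : ∀ {b} (v : Vec Bool b) → s (false ∷ v) ≡ s v
      shift   : ∀ N → Vec Bool (suc (N * 2)) → Bool × Vec Bool (N * 2)
      unshift : ∀ N → Bool → Vec Bool (N * 2) → Vec Bool (suc (N * 2))
      shift-unshift : ∀ N e r → shift N (unshift N e r) ≡ (e , r)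
      unshift-shift : ∀ N v → unshift N (proj₁ (shift N v)) (proj₂ (shift N v)) ≡ v
      p-unshift : ∀ N e r → p (unshift N e r) ≡ bit e + s r
      s-unshift : ∀ N e r → s (unshift N e r) ≡ p r
      weight-unshift : ∀ N e r →
        weight (unshift N e r) ≡ bit e * m + (weight r + 3 * (s r + p r))

  module _ {p s : Statistic} (S : Shiftable p s) where
    open Shiftable S

    -- A shifted vector is one bit shorter than `Fibre` asks for. Padding with `false` at the top
    -- rank loses nothing, since a part of rank 2N would exceed `n`.
    Fibre↔Unshift : ∀ N i j n → n < part (N * 2) →
                    Fibre p s N i j n ↔ Unshift (Fibre p s N) i j n
    Fibre↔Unshift N i j n n< = mk↔ₛ′ to from to∘from from∘to
      where
      to : Fibre p s N i j n → Unshift (Fibre p s N) i j n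
      to (v , p≡ , s≡ , w≡) with shift N v | unshift-shift N v
      ... | e , r | refl =
        (e , s r , weight r) ,
        (trans (sym (p-unshift N e r)) p≡ ,
         trans (cong (λ x → bit e * m + (weight r + 3 * (s r + x)))
                     (trans (sym s≡) (s-unshift N e r)))
               (trans (sym (weight-unshift N e r)) w≡)) ,
        (false ∷ r , trans (p-false r) (trans (sym (s-unshift N e r)) s≡) , s-false r , refl)

      from : Unshift (Fibre p s N) i j n → Fibre p s N i j n
      -- A `true` top bit would give weight at least `part (N * 2)`, against `n′ ≤ n`.
      from (x , y , (true ∷ r , _ , _ , refl)) =
        contradiction (≤-<-trans (≤-trans (m≤m+n _ _) (n′≤n x y)) n<) (<-irrefl refl)
      from ((e , i′ , n′) , (i≡ , n≡) , (false ∷ r , p≡ , s≡ , refl)) =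
        unshift N e r ,
        trans (p-unshift N e r) (trans (cong (bit e +_) s≡′) i≡) ,
        trans (s-unshift N e r) p≡′ ,
        trans (weight-unshift N e r)
          (trans (cong (λ x → bit e * m + (weight r + 3 * x)) (cong₂ _+_ s≡′ p≡′)) n≡)
        where
        s≡′ = trans (sym (s-false r)) s≡
        p≡′ = trans (sym (p-false r)) p≡

      -- The vector determines `i′` and `n′`, so bit and vector fix the element.
      Unshift-≡ : (y z : Unshift (Fibre p s N) i j n) → proj₁ (proj₁ y) ≡ proj₁ (proj₁ z) →
                  proj₁ (proj₂ (proj₂ y)) ≡ proj₁ (proj₂ (proj₂ z)) → y ≡ z
      Unshift-≡ (_ , (refl , refl) , (_ , refl , refl , refl))
                (_ , (i≡ , n≡) , (_ , p≡ , refl , refl)) refl refl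
        with refl ← i≡ | refl ← n≡ | refl ← p≡ = refl

      to∘from : ∀ z → to (from z) ≡ z
      to∘from (x , y , (true ∷ r , _ , _ , refl)) =
        contradiction (≤-<-trans (≤-trans (m≤m+n _ _) (n′≤n x y)) n<) (<-irrefl refl)
      to∘from z@((e , _ , _) , _ , (false ∷ r , _ , _ , refl)) =
        Unshift-≡ _ _ (trans (to-bit (from z)) (cong proj₁ (shift-unshift N e r)))
                      (trans (to-vec (from z)) (cong (λ q → false ∷ proj₂ q) (shift-unshift N e r)))
        where
        to-bit : ∀ y → proj₁ (proj₁ (to y)) ≡ proj₁ (shift N (proj₁ y))
        to-bit (v , _) with shift N v | unshift-shift N v
        ... | _ , _ | refl = refl
        to-vec : ∀ y → proj₁ (proj₂ (proj₂ (to y))) ≡ false ∷ proj₂ (shift N (proj₁ y))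
        to-vec (v , _) with shift N v | unshift-shift N v
        ... | _ , _ | refl = refl

      from∘to : ∀ z → from (to z) ≡ z
      from∘to z = Σ-≡ (×-irrelevant ≡-irrelevant (×-irrelevant ≡-irrelevant ≡-irrelevant)) (vec z)
        where
        vec : ∀ y → proj₁ (from (to y)) ≡ proj₁ y
        vec (v , _) with shift N v | unshift-shift N v
        ... | _ , _ | refl = refl

  -- Comparison of two solutions of the recurrence.

  module _ {p s p′ s′ : Statistic} (S : Shiftable p s) (S′ : Shiftable p′ s′)
           (total : ∀ {b} (v : Vec Bool b) → p v + s v ≡ p′ v + s′ v) where

    -- Two counts both vanish exactly when their sum does, and the sums agree, so the same vectors
    -- qualify.
    Fibre₀↔Fibre₀ : ∀ N n → Fibre p s N 0 0 n ↔ Fibre p′ s′ N 0 0 n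
    Fibre₀↔Fibre₀ N n = congˡ λ {v} → mk↔ₛ′
      (transport (total v)) (transport (sym (total v)))
      (λ _ → ×-irrelevant ≡-irrelevant (×-irrelevant ≡-irrelevant ≡-irrelevant) _ _)
      (λ _ → ×-irrelevant ≡-irrelevant (×-irrelevant ≡-irrelevant ≡-irrelevant) _ _)
      where
      transport : ∀ {a b c d w} → a + b ≡ c + d →
                  a ≡ 0 × b ≡ 0 × w ≡ n → c ≡ 0 × d ≡ 0 × w ≡ n
      transport {c = c} eq (refl , refl , w≡) =
        m+n≡0⇒m≡0 c (sym eq) , m+n≡0⇒n≡0 c (sym eq) , w≡

    -- `k` is fuel bounding the measure. `N` stays fixed: weights never grow, so the bound by
    -- `part (N * 2)` persists.
    Fibre↔Fibre : ∀ N k i j n → i + j + n ≤ k → n < part (N * 2) →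
                  Fibre p s N i j n ↔ Fibre p′ s′ N i j n
    Fibre↔Fibre-step : ∀ N k i j n → 0 < i + j → i + j + n ≤ k → n < part (N * 2) →
                       Fibre p s N i j n ↔ Fibre p′ s′ N i j n

    Fibre↔Fibre N k zero    zero    n _  _  = Fibre₀↔Fibre₀ N n
    Fibre↔Fibre N k zero    (suc j) n ≤k n< = Fibre↔Fibre-step N k zero (suc j) n (s≤s z≤n) ≤k n<
    Fibre↔Fibre N k (suc i) j       n ≤k n< = Fibre↔Fibre-step N k (suc i) j n (s≤s z≤n) ≤k n<

    Fibre↔Fibre-step N zero i j n 0<i+j ≤k n< =
      contradiction (≤-trans 0<i+j (≤-trans (m≤m+n (i + j) n) ≤k)) λ ()
    Fibre↔Fibre-step N (suc k) i j n 0<i+j ≤k n< =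
      ↔-trans (Fibre↔Unshift S N i j n n<)
        -- The shifted parameters range over the same set for both pairs of statistics, so the
        -- induction applies componentwise.
        (↔-trans (congˡ λ {x} → congˡ λ {y} →
                   Fibre↔Fibre N k j _ _ (≤-pred (≤-trans (Shifted-decreases 0<i+j x y) ≤k))
                                       (≤-<-trans (n′≤n x y) n<))
                 (↔-sym (Fibre↔Unshift S′ N i j n n<)))

  -- Statistics by the parity of the position

  odds evens : Statistic
  odds v  = countMod 3 m (oddIndexed (parts v))
  evens v = countMod 3 m (evenIndexed (parts v))

  odds-true : ∀ {b} (v : Vec Bool b) → odds (true ∷ v) ≡ α b + β b + evens v
  odds-true {b} v =
    trans (countMod-∷ 3 m (part b) _) (cong (_+ evens v) (countMod3-part b))

  odds-true-even : ∀ N (v : Vec Bool (N * 2)) → odds (true ∷ v) ≡ 1 + evens v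
  odds-true-even N v = trans (odds-true v) (cong (_+ evens v) (α+β-even N))

  -- Odd ranks hold the multiples of 3, which move all later parts by one position and are not
  -- counted. The companion `evens (true ∷ v) ≡ odds v` holds by computation.
  odds-true-odd : ∀ N (v : Vec Bool (suc (N * 2))) → odds (true ∷ v) ≡ evens v
  odds-true-odd N v = trans (odds-true v) (cong (_+ evens v) (cong₂ _+_ (α-odd N) (β-odd N)))

  -- The recursive call returns the choice of the next single below, or the bit of `m` if there is
  -- none. A single adopts it, as `not e ∷ e` on the parts 3c and 3(c-1)+m, and sends its own choice
  -- up.
  shiftᴵ : ∀ N → Vec Bool (suc (N * 2)) → Bool × Vec Bool (N * 2)
  shiftᴵ zero    (e ∷ [])    = e , []
  shiftᴵ (suc N) (x ∷ y ∷ v) with shiftᴵ N v | x | y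
  ... | e , r | true  | true  = e , true ∷ true ∷ r
  ... | e , r | false | false = e , false ∷ false ∷ r
  ... | e , r | true  | false = true , not e ∷ e ∷ r
  ... | e , r | false | true  = false , not e ∷ e ∷ r

  unshiftᴵ : ∀ N → Bool → Vec Bool (N * 2) → Vec Bool (suc (N * 2))
  unshiftᴵ zero    e []                  = e ∷ []
  unshiftᴵ (suc N) e (true ∷ true ∷ r)   = true ∷ true ∷ unshiftᴵ N e r
  unshiftᴵ (suc N) e (false ∷ false ∷ r) = false ∷ false ∷ unshiftᴵ N e r
  -- The single takes the incoming choice `e` and hands its own down: 3c as `false`, 3(c-1)+m as
  -- `true`.
  unshiftᴵ (suc N) e (true ∷ false ∷ r)  = e ∷ not e ∷ unshiftᴵ N false r
  unshiftᴵ (suc N) e (false ∷ true ∷ r)  = e ∷ not e ∷ unshiftᴵ N true r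

  shift-unshiftᴵ : ∀ N e r → shiftᴵ N (unshiftᴵ N e r) ≡ (e , r)
  shift-unshiftᴵ zero    e     []                  = refl
  shift-unshiftᴵ (suc N) e     (true ∷ true ∷ r)   rewrite shift-unshiftᴵ N e r = refl
  shift-unshiftᴵ (suc N) e     (false ∷ false ∷ r) rewrite shift-unshiftᴵ N e r = refl
  shift-unshiftᴵ (suc N) true  (true ∷ false ∷ r)  rewrite shift-unshiftᴵ N false r = refl
  shift-unshiftᴵ (suc N) false (true ∷ false ∷ r)  rewrite shift-unshiftᴵ N false r = refl
  shift-unshiftᴵ (suc N) true  (false ∷ true ∷ r)  rewrite shift-unshiftᴵ N true r = refl
  shift-unshiftᴵ (suc N) false (false ∷ true ∷ r)  rewrite shift-unshiftᴵ N true r = refl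

  unshift-shiftᴵ : ∀ N v → unshiftᴵ N (proj₁ (shiftᴵ N v)) (proj₂ (shiftᴵ N v)) ≡ v
  unshift-shiftᴵ zero    (e ∷ [])    = refl
  unshift-shiftᴵ (suc N) (x ∷ y ∷ v) with shiftᴵ N v | unshift-shiftᴵ N v | x | y
  ... | e     , r | eq | true  | true  = cong (λ w → true ∷ true ∷ w) eq
  ... | e     , r | eq | false | false = cong (λ w → false ∷ false ∷ w) eq
  ... | true  , r | eq | true  | false = cong (λ w → true ∷ false ∷ w) eq
  ... | false , r | eq | true  | false = cong (λ w → true ∷ false ∷ w) eq
  ... | true  , r | eq | false | true  = cong (λ w → false ∷ true ∷ w) eq
  ... | false , r | eq | false | true  = cong (λ w → false ∷ true ∷ w) eq

  -- The induction is mutual: a single moves everything below it by one position, so its case calls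
  -- the other claim, while full and empty pairs preserve parity and stay with the same claim.
  odds-unshiftᴵ  : ∀ N e r → odds (unshiftᴵ N e r) ≡ bit e + evens r
  evens-unshiftᴵ : ∀ N e r → evens (unshiftᴵ N e r) ≡ odds r

  odds-unshiftᴵ zero true  [] = odds-true-even 0 []
  odds-unshiftᴵ zero false [] = refl
  odds-unshiftᴵ (suc N) e (true ∷ true ∷ r) = begin
    odds (true ∷ true ∷ v)          ≡⟨ odds-true-even (suc N) (true ∷ v) ⟩
    1 + odds v                      ≡⟨ cong suc (odds-unshiftᴵ N e r) ⟩
    1 + (bit e + evens r)           ≡⟨ +-suc (bit e) (evens r) ⟨
    bit e + (1 + evens r)           ≡⟨ cong (bit e +_) (odds-true-even N r) ⟨
    bit e + evens (true ∷ true ∷ r) ∎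
    where
    open ≡-Reasoning
    v = unshiftᴵ N e r
  odds-unshiftᴵ (suc N) e (false ∷ false ∷ r) = odds-unshiftᴵ N e r
  odds-unshiftᴵ (suc N) true (true ∷ false ∷ r) =
    trans (odds-true-even (suc N) (false ∷ unshiftᴵ N false r)) (cong suc (evens-unshiftᴵ N false r))
  odds-unshiftᴵ (suc N) false (true ∷ false ∷ r) =
    trans (odds-true-odd N (unshiftᴵ N false r)) (evens-unshiftᴵ N false r)
  odds-unshiftᴵ (suc N) true (false ∷ true ∷ r) =
    trans (odds-true-even (suc N) (false ∷ unshiftᴵ N true r)) (cong suc (evens-unshiftᴵ N true r))
  odds-unshiftᴵ (suc N) false (false ∷ true ∷ r) =
    trans (odds-true-odd N (unshiftᴵ N true r)) (evens-unshiftᴵ N true r)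

  evens-unshiftᴵ zero true  [] = refl
  evens-unshiftᴵ zero false [] = refl
  evens-unshiftᴵ (suc N) e (true ∷ true ∷ r) = begin
    odds (true ∷ unshiftᴵ N e r) ≡⟨ odds-true-odd N (unshiftᴵ N e r) ⟩
    evens (unshiftᴵ N e r)       ≡⟨ evens-unshiftᴵ N e r ⟩
    odds r                       ≡⟨ odds-true-odd N (true ∷ r) ⟨
    odds (true ∷ true ∷ r)       ∎
    where open ≡-Reasoning
  evens-unshiftᴵ (suc N) e (false ∷ false ∷ r) = evens-unshiftᴵ N e r
  evens-unshiftᴵ (suc N) true (true ∷ false ∷ r) =
    trans (odds-unshiftᴵ N false r) (sym (odds-true-odd N (false ∷ r)))
  evens-unshiftᴵ (suc N) false (true ∷ false ∷ r) =
    trans (odds-unshiftᴵ N false r) (sym (odds-true-odd N (false ∷ r)))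
  -- The unit counted by the bit handed down is, on the right, the part of rank 2N in `true ∷ r`.
  evens-unshiftᴵ (suc N) true (false ∷ true ∷ r) =
    trans (odds-unshiftᴵ N true r) (sym (odds-true-even N r))
  evens-unshiftᴵ (suc N) false (false ∷ true ∷ r) =
    trans (odds-unshiftᴵ N true r) (sym (odds-true-even N r))

  -- Weight identities for one pair of ranks.

  -- Throughout, `u` stands for 3c and `w` for 3(c-1)+m; `r` and `t` are the weight and number of
  -- marks of the lower bits, and `v` is their weight after unshifting.
  weight-both : ∀ u w e v r t →
    v ≡ e * m + (r + 3 * t) → 3 + w + (u + v) ≡ e * m + (u + (w + r) + 3 * (1 + t))
  weight-both u w e _ r t refl = identity u w (e * m) r t
    where
    identity : ∀ u w e r t →
      3 + w + (u + (e + (r + 3 * t))) ≡ e + (u + (w + r) + 3 * (1 + t))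
    identity = solve-∀

  weight-high : ∀ w v r t x → v ≡ x + (r + 3 * t) → 3 + w + v ≡ x + (w + r + 3 * (1 + t))
  weight-high w _ r t x refl = identity w r t x
    where
    identity : ∀ w r t x → 3 + w + (x + (r + 3 * t)) ≡ x + (w + r + 3 * (1 + t))
    identity = solve-∀

  weight-low : ∀ u v r t x → v ≡ x + (r + 3 * t) → u + v ≡ x + (u + r + 3 * t)
  weight-low u _ r t x refl = identity u r t x
    where
    identity : ∀ u r t x → u + (x + (r + 3 * t)) ≡ x + (u + r + 3 * t)
    identity = solve-∀

  -- The extra `m` carried by the incoming choice turns 3c into 3c+m, and no choice is handed down.
  weight-lower : ∀ u w v r t → u + m ≡ 3 + w → v ≡ r + 3 * t →
                 3 + w + v ≡ 1 * m + (u + r + 3 * t)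
  weight-lower u w _ r t eq refl = trans (cong (_+ (r + 3 * t)) (sym eq)) (identity u m r t)
    where
    identity : ∀ u m r t → u + m + (r + 3 * t) ≡ 1 * m + (u + r + 3 * t)
    identity = solve-∀

  -- The part `w` is replaced by 3c while its choice goes down as `1 * m`; together they make up `w`
  -- raised by 3.
  weight-raise : ∀ u w v r t → u + m ≡ 3 + w → v ≡ 1 * m + (r + 3 * t) →
                 u + v ≡ w + r + 3 * (1 + t)
  weight-raise u w _ r t eq refl =
    trans (identity₁ u m r t) (trans (cong (_+ (r + 3 * t)) eq) (identity₂ w r t))
    where
    identity₁ : ∀ u m r t → u + (1 * m + (r + 3 * t)) ≡ u + m + (r + 3 * t)
    identity₁ = solve-∀
    identity₂ : ∀ w r t → 3 + w + (r + 3 * t) ≡ w + r + 3 * (1 + t)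
    identity₂ = solve-∀

  weight-unshiftᴵ : ∀ N e r →
    weight (unshiftᴵ N e r) ≡ bit e * m + (weight r + 3 * (evens r + odds r))
  weight-unshiftᴵ zero true  [] = cong (_+ 0) (sym (+-identityʳ m))
  weight-unshiftᴵ zero false [] = refl
  weight-unshiftᴵ (suc N) e (true ∷ true ∷ r)
    rewrite odds-true-odd N (true ∷ r) | odds-true-even N r =
    weight-both (part (suc (N * 2))) (part (N * 2)) (bit e) _ (weight r) (evens r + odds r)
      (weight-unshiftᴵ N e r)
  weight-unshiftᴵ (suc N) e (false ∷ false ∷ r) = weight-unshiftᴵ N e r
  weight-unshiftᴵ (suc N) true (true ∷ false ∷ r)
    -- Below a single the two statistics of `r` appear exchanged; `+-comm` restores their order.
    rewrite odds-true-odd N (false ∷ r) | +-comm (odds r) (evens r) =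
    weight-lower (part (suc (N * 2))) (part (N * 2)) _ (weight r) (evens r + odds r)
      (part-odd N) (weight-unshiftᴵ N false r)
  weight-unshiftᴵ (suc N) false (true ∷ false ∷ r)
    rewrite odds-true-odd N (false ∷ r) | +-comm (odds r) (evens r) =
    weight-low (part (suc (N * 2))) _ (weight r) (evens r + odds r) 0 (weight-unshiftᴵ N false r)
  weight-unshiftᴵ (suc N) true (false ∷ true ∷ r)
    rewrite odds-true-even N r | +-suc (odds r) (evens r) | +-comm (odds r) (evens r) =
    weight-high (part (N * 2)) _ (weight r) (evens r + odds r) (1 * m) (weight-unshiftᴵ N true r)
  weight-unshiftᴵ (suc N) false (false ∷ true ∷ r)
    rewrite odds-true-even N r | +-suc (odds r) (evens r) | +-comm (odds r) (evens r) =
    weight-raise (part (suc (N * 2))) (part (N * 2)) _ (weight r) (evens r + odds r)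
      (part-odd N) (weight-unshiftᴵ N true r)

  shiftableᴵ : Shiftable odds evens
  shiftableᴵ = record
    { p-false = λ _ → refl
    ; s-false = λ _ → refl
    ; shift = shiftᴵ
    ; unshift = unshiftᴵ
    ; shift-unshift = shift-unshiftᴵ
    ; unshift-shift = unshift-shiftᴵ
    ; p-unshift = odds-unshiftᴵ
    ; s-unshift = evens-unshiftᴵ
    ; weight-unshift = weight-unshiftᴵ
    }

  -- Statistics by the residue modulo 6

  zeros threes : Statistic
  zeros v  = countMod 6 m (parts v)
  threes v = countMod 6 (m + 3) (parts v)

  zeros-true : ∀ {b} (v : Vec Bool b) → zeros (true ∷ v) ≡ α b + zeros v
  zeros-true {b} v =
    trans (countMod-∷ 6 m (part b) _) (cong (_+ zeros v) (proj₁ (countMod6-part b)))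

  threes-true : ∀ {b} (v : Vec Bool b) → threes (true ∷ v) ≡ β b + threes v
  threes-true {b} v =
    trans (countMod-∷ 6 (m + 3) (part b) _) (cong (_+ threes v) (proj₂ (countMod6-part b)))

  zeros-true-odd : ∀ N (v : Vec Bool (suc (N * 2))) → zeros (true ∷ v) ≡ zeros v
  zeros-true-odd N v = trans (zeros-true v) (cong (_+ zeros v) (α-odd N))

  threes-true-odd : ∀ N (v : Vec Bool (suc (N * 2))) → threes (true ∷ v) ≡ threes v
  threes-true-odd N v = trans (threes-true v) (cong (_+ threes v) (β-odd N))

  -- Swapping a pair lowers `x` by two ranks, from 3c+m to 3(c-1)+m, and leaves `y` at 3c. The last
  -- bit, that of `m`, is split off.
  shiftᴵᴵ : ∀ N → Vec Bool (suc (N * 2)) → Bool × Vec Bool (N * 2)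
  shiftᴵᴵ zero    (e ∷ [])    = e , []
  shiftᴵᴵ (suc N) (x ∷ y ∷ v) = proj₁ (shiftᴵᴵ N v) , y ∷ x ∷ proj₂ (shiftᴵᴵ N v)

  unshiftᴵᴵ : ∀ N → Bool → Vec Bool (N * 2) → Vec Bool (suc (N * 2))
  unshiftᴵᴵ zero    e []          = e ∷ []
  unshiftᴵᴵ (suc N) e (y ∷ x ∷ r) = x ∷ y ∷ unshiftᴵᴵ N e r

  shift-unshiftᴵᴵ : ∀ N e r → shiftᴵᴵ N (unshiftᴵᴵ N e r) ≡ (e , r)
  shift-unshiftᴵᴵ zero    e []          = refl
  shift-unshiftᴵᴵ (suc N) e (y ∷ x ∷ r) rewrite shift-unshiftᴵᴵ N e r = refl

  unshift-shiftᴵᴵ : ∀ N v → unshiftᴵᴵ N (proj₁ (shiftᴵᴵ N v)) (proj₂ (shiftᴵᴵ N v)) ≡ v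
  unshift-shiftᴵᴵ zero    (e ∷ [])    = refl
  unshift-shiftᴵᴵ (suc N) (x ∷ y ∷ v) = cong (λ w → x ∷ y ∷ w) (unshift-shiftᴵᴵ N v)

  +-swap : ∀ a b c → a + (b + c) ≡ b + (a + c)
  +-swap = solve-∀

  -- Here `x` has rank 2N+2, where `α` takes the value `β (N * 2)`. In the primed versions `x` has
  -- rank 2N, so comparing the two gives the exchange of residues.
  zeros-∷∷ : ∀ N x y (v : Vec Bool (suc (N * 2))) → zeros (x ∷ y ∷ v) ≡ bit x * β (N * 2) + zeros v
  zeros-∷∷ N false false v = refl
  zeros-∷∷ N false true  v = zeros-true-odd N v
  zeros-∷∷ N true  false v = trans (zeros-true (false ∷ v)) (cong (_+ zeros v) (sym (+-identityʳ _)))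
  zeros-∷∷ N true  true  v =
    trans (zeros-true (true ∷ v)) (cong₂ _+_ (sym (+-identityʳ _)) (zeros-true-odd N v))

  threes-∷∷ : ∀ N x y (v : Vec Bool (suc (N * 2))) → threes (x ∷ y ∷ v) ≡ bit x * α (N * 2) + threes v
  threes-∷∷ N false false v = refl
  threes-∷∷ N false true  v = threes-true-odd N v
  threes-∷∷ N true  false v = trans (threes-true (false ∷ v)) (cong (_+ threes v) (sym (+-identityʳ _)))
  threes-∷∷ N true  true  v =
    trans (threes-true (true ∷ v)) (cong₂ _+_ (sym (+-identityʳ _)) (threes-true-odd N v))

  zeros-∷∷′ : ∀ N x y (r : Vec Bool (N * 2)) → zeros (y ∷ x ∷ r) ≡ bit x * α (N * 2) + zeros r
  zeros-∷∷′ N false false r = refl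
  zeros-∷∷′ N false true  r = zeros-true-odd N (false ∷ r)
  zeros-∷∷′ N true  false r = trans (zeros-true r) (cong (_+ zeros r) (sym (+-identityʳ _)))
  zeros-∷∷′ N true  true  r = trans (zeros-true-odd N (true ∷ r)) (zeros-∷∷′ N true false r)

  threes-∷∷′ : ∀ N x y (r : Vec Bool (N * 2)) → threes (y ∷ x ∷ r) ≡ bit x * β (N * 2) + threes r
  threes-∷∷′ N false false r = refl
  threes-∷∷′ N false true  r = threes-true-odd N (false ∷ r)
  threes-∷∷′ N true  false r = trans (threes-true r) (cong (_+ threes r) (sym (+-identityʳ _)))
  threes-∷∷′ N true  true  r = trans (threes-true-odd N (true ∷ r)) (threes-∷∷′ N true false r)

  zeros-unshiftᴵᴵ : ∀ N e r → zeros (unshiftᴵᴵ N e r) ≡ bit e + threes r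
  zeros-unshiftᴵᴵ zero true  [] = zeros-true []
  zeros-unshiftᴵᴵ zero false [] = refl
  zeros-unshiftᴵᴵ (suc N) e (y ∷ x ∷ r) = begin
    zeros (x ∷ y ∷ unshiftᴵᴵ N e r)                ≡⟨ zeros-∷∷ N x y _ ⟩
    bit x * β (N * 2) + zeros (unshiftᴵᴵ N e r)    ≡⟨ cong (bit x * β (N * 2) +_) (zeros-unshiftᴵᴵ N e r) ⟩
    bit x * β (N * 2) + (bit e + threes r)         ≡⟨ +-swap (bit x * β (N * 2)) (bit e) (threes r) ⟩
    bit e + (bit x * β (N * 2) + threes r)         ≡⟨ cong (bit e +_) (threes-∷∷′ N x y r) ⟨
    bit e + threes (y ∷ x ∷ r)                     ∎
    where open ≡-Reasoning

  threes-unshiftᴵᴵ : ∀ N e r → threes (unshiftᴵᴵ N e r) ≡ zeros r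
  threes-unshiftᴵᴵ zero true  [] = threes-true []
  threes-unshiftᴵᴵ zero false [] = refl
  threes-unshiftᴵᴵ (suc N) e (y ∷ x ∷ r) = begin
    threes (x ∷ y ∷ unshiftᴵᴵ N e r)              ≡⟨ threes-∷∷ N x y _ ⟩
    bit x * α (N * 2) + threes (unshiftᴵᴵ N e r)  ≡⟨ cong (bit x * α (N * 2) +_) (threes-unshiftᴵᴵ N e r) ⟩
    bit x * α (N * 2) + zeros r                   ≡⟨ zeros-∷∷′ N x y r ⟨
    zeros (y ∷ x ∷ r)                             ∎
    where open ≡-Reasoning

  -- An even rank carries exactly one of the two marks, so `x` alone decides whether the pair is
  -- charged 3.
  marks-∷∷′ : ∀ N x y (r : Vec Bool (N * 2)) →
              threes (y ∷ x ∷ r) + zeros (y ∷ x ∷ r) ≡ bit x + (threes r + zeros r)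
  marks-∷∷′ N x y r = begin
    threes (y ∷ x ∷ r) + zeros (y ∷ x ∷ r)     ≡⟨ cong₂ _+_ (threes-∷∷′ N x y r) (zeros-∷∷′ N x y r) ⟩
    bit x * b + threes r + (bit x * a + zeros r) ≡⟨ identity (bit x) a b (threes r) (zeros r) ⟩
    bit x * (a + b) + (threes r + zeros r)       ≡⟨ cong (λ c → bit x * c + (threes r + zeros r)) (α+β-even N) ⟩
    bit x * 1 + (threes r + zeros r)             ≡⟨ cong (_+ (threes r + zeros r)) (*-identityʳ (bit x)) ⟩
    bit x + (threes r + zeros r)                 ∎
    where
    open ≡-Reasoning
    a = α (N * 2)
    b = β (N * 2)
    identity : ∀ x a b t z → x * b + t + (x * a + z) ≡ x * (a + b) + (t + z)
    identity = solve-∀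

  weight-unshiftᴵᴵ : ∀ N e r →
    weight (unshiftᴵᴵ N e r) ≡ bit e * m + (weight r + 3 * (threes r + zeros r))
  weight-unshiftᴵᴵ zero true  [] = cong (_+ 0) (sym (+-identityʳ m))
  weight-unshiftᴵᴵ zero false [] = refl
  weight-unshiftᴵᴵ (suc N) e (y ∷ x ∷ r) =
    trans (go x y)
      (cong (λ t → bit e * m + (weight (y ∷ x ∷ r) + 3 * t)) (sym (marks-∷∷′ N x y r)))
    where
    ih = weight-unshiftᴵᴵ N e r
    go : ∀ x y → weight (x ∷ y ∷ unshiftᴵᴵ N e r) ≡
                 bit e * m + (weight (y ∷ x ∷ r) + 3 * (bit x + (threes r + zeros r)))
    go false false = ih
    go false true  = weight-low (part (suc (N * 2))) _ (weight r) (threes r + zeros r) (bit e * m) ih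
    go true  false = weight-high (part (N * 2)) _ (weight r) (threes r + zeros r) (bit e * m) ih
    go true  true  =
      weight-both (part (suc (N * 2))) (part (N * 2)) (bit e) _ (weight r) (threes r + zeros r) ih

  shiftableᴵᴵ : Shiftable zeros threes
  shiftableᴵᴵ = record
    { p-false = λ _ → refl
    ; s-false = λ _ → refl
    ; shift = shiftᴵᴵ
    ; unshift = unshiftᴵᴵ
    ; shift-unshift = shift-unshiftᴵᴵ
    ; unshift-shift = unshift-shiftᴵᴵ
    ; p-unshift = zeros-unshiftᴵᴵ
    ; s-unshift = threes-unshiftᴵᴵ
    ; weight-unshift = weight-unshiftᴵᴵ
    }

  -- The common total and the final bijection.

  -- Both sums count the parts congruent to `m` modulo 3, split by position or by residue modulo 6.
  odds+evens≡zeros+threes : ∀ {b} (v : Vec Bool b) → odds v + evens v ≡ zeros v + threes v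
  odds+evens≡zeros+threes []                  = refl
  odds+evens≡zeros+threes (false ∷ v)         = odds+evens≡zeros+threes v
  odds+evens≡zeros+threes {suc b} (true ∷ v)  = begin
    odds (true ∷ v) + odds v              ≡⟨ cong (_+ odds v) (odds-true v) ⟩
    α b + β b + evens v + odds v          ≡⟨ identity₁ (α b) (β b) (odds v) (evens v) ⟩
    α b + β b + (odds v + evens v)        ≡⟨ cong (α b + β b +_) (odds+evens≡zeros+threes v) ⟩
    α b + β b + (zeros v + threes v)      ≡⟨ identity₂ (α b) (β b) (zeros v) (threes v) ⟩
    α b + zeros v + (β b + threes v)      ≡⟨ cong₂ _+_ (zeros-true v) (threes-true v) ⟨
    zeros (true ∷ v) + threes (true ∷ v)  ∎
    where
    open ≡-Reasoning
    identity₁ : ∀ a b o e → a + b + e + o ≡ a + b + (o + e)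
    identity₁ = solve-∀
    identity₂ : ∀ a b z t → a + b + (z + t) ≡ a + z + (b + t)
    identity₂ = solve-∀

  DI↔DII : ∀ i j n → DI m i j n ↔ DII m i j n
  DI↔DII i j n =
    ↔-trans (partitions↔vectors b n n<part[b]
               (λ π → countMod 3 m (oddIndexed π)) (λ π → countMod 3 m (evenIndexed π)) i j)
    -- Taking `N` to be `n` leaves enough ranks, and the fuel is the measure `i + j + n` itself.
    (↔-trans (Fibre↔Fibre shiftableᴵ shiftableᴵᴵ odds+evens≡zeros+threes n _ i j n
                ≤-refl (n<part[n*2] n))
             (↔-sym (partitions↔vectors b n n<part[b] (countMod 6 m) (countMod 6 (m + 3)) i j)))
    where
    b = suc (n * 2)
    n<part[b] : n < part b
    n<part[b] = <-trans (n<part[n*2] n) (part-mono-< (n<1+n (n * 2)))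

theorem3p6 : (m i j n : ℕ) → (m ≡ 1 ⊎ m ≡ 2) → DI m i j n ↔ DII m i j n
theorem3p6 m i j n m∈ = Parts.DI↔DII m m∈ i j n
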